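{- Let $G$ be a simple undirected graph on $n$ vertices with minimum degree $\delta(G)=1$. Then the maximum $\alpha\in(0,1)$ such that $B_\alpha(G)=\alpha A(G)+(1-\alpha)L(G)$ is positive semi-definite is $$\beta_0(G)=\frac{\lambda_n(\mathcal{A})-1}{2\lambda_n(\mathcal{A})-1}.$$
   Context: For a graph $G$ on $n$ vertices, $A(G)$ is the $n\times n$ adjacency matrix, $D=D(G)$ is the diagonal matrix of vertex degrees, $L(G)=D(G)-A(G)$ is the Laplacian matrix, and $\mathcal{A}=\mathcal{A}(G)=D^{ -1/2}A(G)D^{ -1/2}$ is the normalized adjacency matrix. For a real symmetric $n\times n$ matrix $M$, $\lambda_n(M)$ denotes its smallest eigenvalue. For $\alpha\in[0,1]$, $B_\alpha(G)=\alpha A(G)+(1-\alpha)L(G)$. -}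

module Defs where

open import Level using (Level; 0ℓ) renaming (suc to lsuc)
open import Algebra.Bundles using (CommutativeRing)
open import Data.Bool.Base using (if_then_else_)
open import Data.Fin.Base using (Fin)
open import Data.Fin.Properties using (_≟_)
open import Data.Nat.Base as ℕ using (ℕ)
open import Data.Product.Base using (∃; _×_; _,_; proj₁)
open import Data.Sum.Base using (inj₁; inj₂)
open import Data.Vec.Base using (allFin; count)
open import Data.Vec.Functional using (Vector)
open import Relation.Binary.Core using (Rel)
open import Relation.Binary.Definitions using (Decidable; Irreflexive; Symmetric)
open import Relation.Binary.PropositionalEquality.Core using (_≡_)
open import Relation.Binary.Structures using (IsDecTotalOrder)
open import Relation.Nullary.Decidable.Core using (does)
open import Relation.Nullary.Negation.Core using (¬_)
open import Relation.Unary using (Pred)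

import Algebra.Properties.Ring as RingProperties
import Algebra.Properties.Semiring.Mult as SemiringMult
import Algebra.Properties.Semiring.Sum as SemiringSum
import Relation.Binary.Construct.NonStrictToStrict as ToStrict

record SimpleGraph (n : ℕ) : Set₁ where
  infix 4 _~_ _~?_
  field
    _~_      : Rel (Fin n) 0ℓ
    _~?_     : Decidable _~_
    ~-sym    : Symmetric _~_
    ~-irrefl : Irreflexive _≡_ _~_

  degree : Fin n → ℕ
  degree v = count (v ~?_) (allFin n)

HasMinDegree : ∀ {n} → SimpleGraph n → ℕ → Set
HasMinDegree G d = (∃ λ v → degree v ≡ d) × (∀ v → d ℕ.≤ degree v)
  where open SimpleGraph G

-- The library has no real numbers. They are characterised, uniquely up to
-- isomorphism, as the Dedekind-complete ordered field; the decidable order is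
-- the classical reading. As usual x ⁻¹ is total, with 0# ⁻¹ left unspecified.
record CompleteOrderedField (ℓ : Level) : Set (lsuc ℓ) where
  field
    commutativeRing : CommutativeRing ℓ ℓ

  open CommutativeRing commutativeRing public

  infix  8 _⁻¹
  infix  4 _≤_

  field
    0≉1             : ¬ 0# ≈ 1#
    _⁻¹             : Carrier → Carrier
    ⁻¹-cong         : ∀ {x y} → x ≈ y → x ⁻¹ ≈ y ⁻¹
    *-inverseʳ      : ∀ {x} → ¬ x ≈ 0# → x * x ⁻¹ ≈ 1#
    _≤_             : Rel Carrier ℓ
    isDecTotalOrder : IsDecTotalOrder _≈_ _≤_
    +-monoˡ-≤       : ∀ {x y} z → x ≤ y → x + z ≤ y + z
    *-nonNegative   : ∀ {x y} → 0# ≤ x → 0# ≤ y → 0# ≤ x * y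

  UpperBound : Pred Carrier ℓ → Pred Carrier ℓ
  UpperBound P u = ∀ {x} → P x → x ≤ u

  IsSupremum : Pred Carrier ℓ → Pred Carrier ℓ
  IsSupremum P s = UpperBound P s × (∀ u → UpperBound P u → s ≤ u)

  field
    supremum : (P : Pred Carrier ℓ) → ∃ P → ∃ (UpperBound P) → ∃ (IsSupremum P)

  module ≤ = IsDecTotalOrder isDecTotalOrder

  open ToStrict _≈_ _≤_ public using (_<_)
  open SemiringMult semiring public using () renaming (_×_ to _·_)

  IsMaximum : Pred Carrier ℓ → Pred Carrier ℓ
  IsMaximum P m = P m × UpperBound P m

  private
    open RingProperties ring using (-‿involutive; -‿distribˡ-*; -‿distribʳ-*)

    ≤-cong : ∀ {x x′ y y′} → x ≈ x′ → y ≈ y′ → x ≤ y → x′ ≤ y′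
    ≤-cong x≈x′ y≈y′ x≤y = ≤.≤-respʳ-≈ y≈y′ (≤.≤-respˡ-≈ x≈x′ x≤y)

    y≤x⇒0≤x-y : ∀ {x y} → y ≤ x → 0# ≤ x - y
    y≤x⇒0≤x-y {x} {y} y≤x = ≤-cong (-‿inverseʳ y) refl (+-monoˡ-≤ (- y) y≤x)

    x-y+y≈x : ∀ x y → (x - y) + y ≈ x
    x-y+y≈x x y = trans (+-assoc x (- y) y)
                    (trans (+-congˡ (-‿inverseˡ y)) (+-identityʳ x))

    0≤x-y⇒y≤x : ∀ {x y} → 0# ≤ x - y → y ≤ x
    0≤x-y⇒y≤x {x} {y} h = ≤-cong (+-identityˡ y) (x-y+y≈x x y) (+-monoˡ-≤ y h)

    0≤1 : 0# ≤ 1#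
    0≤1 with ≤.total 0# 1#
    ... | inj₁ h = h
    ... | inj₂ h = ≤-cong refl [-1]²≈1 (*-nonNegative 0≤-1 0≤-1)
      where
      0≤-1 : 0# ≤ - 1#
      0≤-1 = ≤-cong refl (+-identityˡ (- 1#)) (y≤x⇒0≤x-y h)
      [-1]²≈1 : - 1# * - 1# ≈ 1#
      [-1]²≈1 = trans (sym (-‿distribˡ-* 1# (- 1#)))
                  (trans (-‿cong (*-identityˡ (- 1#))) (-‿involutive 1#))

    x≤x+y : ∀ x {y} → 0# ≤ y → x ≤ x + y
    x≤x+y x {y} 0≤y = ≤-cong (+-identityˡ x) (+-comm y x) (+-monoˡ-≤ x 0≤y)

    1≤x⇒x≤x² : ∀ {x} → 1# ≤ x → x ≤ x * x
    1≤x⇒x≤x² {x} 1≤x =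
      0≤x-y⇒y≤x (≤-cong refl eq (*-nonNegative (≤.trans 0≤1 1≤x) (y≤x⇒0≤x-y 1≤x)))
      where
      eq : x * (x - 1#) ≈ x * x - x
      eq = trans (distribˡ x x (- 1#))
             (+-congˡ (trans (sym (-‿distribʳ-* x 1#)) (-‿cong (*-identityʳ x))))

  0≤n·1 : ∀ n → 0# ≤ n · 1#
  0≤n·1 ℕ.zero    = ≤.refl
  0≤n·1 (ℕ.suc n) = ≤.trans 0≤1 (x≤x+y 1# (0≤n·1 n))

  √ : ∀ x → 0# ≤ x → Carrier
  √ x 0≤x = proj₁ (supremum (λ y → y * y ≤ x)
                            (0# , ≤-cong (sym (zeroˡ 0#)) refl 0≤x)
                            (1# + x , bound))
    where
    bound : UpperBound (λ y → y * y ≤ x) (1# + x)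
    bound {y} y²≤x with ≤.total y 1#
    ... | inj₁ y≤1 = ≤.trans y≤1 (x≤x+y 1# 0≤x)
    ... | inj₂ 1≤y = ≤.trans (1≤x⇒x≤x² 1≤y)
                       (≤.trans y²≤x (≤-cong refl (+-comm x 1#) (x≤x+y x 0≤1)))

module Matrices {ℓ} (ℝ : CompleteOrderedField ℓ) where
  open CompleteOrderedField ℝ
  open SemiringSum semiring using (sum)

  Matrix : ℕ → Set ℓ
  Matrix n = Fin n → Fin n → Carrier

  infixl 6 _⊕_ _⊖_
  infixl 7 _⊗_ _•_ _⊗ᵥ_

  _⊕_ _⊖_ _⊗_ : ∀ {n} → Matrix n → Matrix n → Matrix n
  (M ⊕ N) i j = M i j + N i j
  (M ⊖ N) i j = M i j - N i j
  (M ⊗ N) i j = sum λ k → M i k * N k j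

  _•_ : ∀ {n} → Carrier → Matrix n → Matrix n
  (a • M) i j = a * M i j

  _⊗ᵥ_ : ∀ {n} → Matrix n → Vector Carrier n → Vector Carrier n
  (M ⊗ᵥ x) i = sum λ j → M i j * x j

  diagonal : ∀ {n} → Vector Carrier n → Matrix n
  diagonal d i j = if does (i ≟ j) then d i else 0#

  IsEigenvalue : ∀ {n} → Matrix n → Pred Carrier ℓ
  IsEigenvalue M μ = ∃ λ x → ¬ (∀ i → x i ≈ 0#) × (∀ i → (M ⊗ᵥ x) i ≈ μ * x i)

  IsSmallestEigenvalue : ∀ {n} → Matrix n → Pred Carrier ℓ
  IsSmallestEigenvalue M μ = IsEigenvalue M μ × (∀ ν → IsEigenvalue M ν → μ ≤ ν)

  PositiveSemidefinite : ∀ {n} → Matrix n → Set ℓ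
  PositiveSemidefinite M =
    (∀ i j → M i j ≈ M j i) × (∀ x → 0# ≤ sum λ i → x i * (M ⊗ᵥ x) i)

  module GraphMatrices {n} (G : SimpleGraph n) where
    open SimpleGraph G

    A : Matrix n
    A i j = if does (i ~? j) then 1# else 0#

    D : Matrix n
    D = diagonal λ v → degree v · 1#

    L : Matrix n
    L = D ⊖ A

    -- Meaningful only when no vertex is isolated.
    D^-½ : Matrix n
    D^-½ = diagonal λ v → √ (degree v · 1#) (0≤n·1 (degree v)) ⁻¹

    𝒜 : Matrix n
    𝒜 = D^-½ ⊗ A ⊗ D^-½

    B : Carrier → Matrix n
    B α = α • A ⊕ (1# - α) • L

{-# OPTIONS --safe #-}
module Submission where

-- Substituting x = D^-½ y turns xᵀ B_α x into (1 - α) |y|² + (2 α - 1) yᵀ 𝒜 y. As G has an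
-- edge and 𝒜 has zero diagonal, λₙ < 0, and since yᵀ 𝒜 y ≥ λₙ |y|² with equality at an
-- eigenvector, B_α is positive semidefinite for an α ≥ ½ exactly when
-- (1 - α) + (2 α - 1) λₙ ≥ 0.
--
-- The variational bound yᵀ 𝒜 y ≥ λₙ |y|² is obtained without compactness: by Schur
-- complements, a positive semidefinite matrix either has a kernel or is coercive.

open import Algebra.Bundles using (CommutativeRing)
open import Algebra.Solver.Ring.AlmostCommutativeRing
  using (_-Raw-AlmostCommutative⟶_; fromCommutativeRing)
open import Data.Empty using (⊥-elim)
open import Data.Fin.Base using (Fin; zero; suc)
open import Data.Integer.Base as ℤ using (ℤ; +_; -[1+_])
import Data.Integer.Properties as ℤ
open import Data.Maybe.Base as Maybe using (Maybe)
open import Data.Nat.Base as ℕ using (ℕ)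
import Data.Nat.Properties as ℕ
open import Data.Product.Base using (∃; _×_; _,_; proj₁; proj₂)
open import Data.Sum.Base using (_⊎_; inj₁; inj₂)
open import Data.Vec.Base as Vec using (Vec)
open import Data.Vec.Functional using (Vector; _∷_)
open import Function.Base using (_∘_)
open import Relation.Binary.Consequences using (dec⇒weaklyDec)
open import Relation.Binary.PropositionalEquality.Core as ≡ using (_≡_)
open import Relation.Nullary.Decidable.Core using (yes; no)
open import Relation.Nullary.Negation.Core using (¬_; contradiction)
open import Relation.Unary as U using (Pred)

open import Defs

-- `λₙ` is given only as the least number that has an eigenvector, so a bound on all vectors has to
-- come from exhibiting one more eigenvector: completeness supplies the number, the infimum of the
-- Rayleigh quotient, and elimination supplies the vector. Deciding at each pivot whether it
-- vanishes is what turns a failure of coercivity into an explicit kernel vector. The constant in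
-- the theorem is the root of `(1 - α) + (2 α - 1) λₙ`, which is affine in `α` with slope
-- `2 λₙ - 1 < 0`. Its value at ½ is ½, so the root lies above ½; there the coefficient of `𝒜` is
-- positive, which is the sign that a lower bound on `yᵀ 𝒜 y` requires. For maximality the
-- eigenvector alone serves as test vector, for every `α` at once.

-- Ring normalisation with integer coefficients.

module IntegerCoefficients {c ℓ} (R : CommutativeRing c ℓ) where
  open CommutativeRing R
  open import Algebra.Properties.Ring ring
    using (-‿involutive; -‿distribˡ-*; -‿distribʳ-*; -0#≈0#; -‿+-comm)
  open import Algebra.Properties.Semiring.Mult.TCOptimised semiring
    using (×-homo-+; ×1-homo-*; 1+×) renaming (_×_ to _·_)
  open import Relation.Binary.Reasoning.Setoid setoid

  -- The optimised multiple makes `1 · 1#` reduce to `1#` itself, so `con (+ 1)` stands for `1#`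
  -- definitionally and solver equations match their goals with `refl`.
  ⟦_⟧ᶻ : ℤ → Carrier
  ⟦ + n ⟧ᶻ      = n · 1#
  ⟦ -[1+ n ] ⟧ᶻ = - (ℕ.suc n · 1#)

  ⟦-_⟧ᶻ : ∀ n → ⟦ ℤ.- (+ n) ⟧ᶻ ≈ - (n · 1#)
  ⟦- ℕ.zero ⟧ᶻ  = sym -0#≈0#
  ⟦- ℕ.suc n ⟧ᶻ = refl

  -‿homo : ∀ i → ⟦ ℤ.- i ⟧ᶻ ≈ - ⟦ i ⟧ᶻ
  -‿homo (+ n)    = ⟦- n ⟧ᶻ
  -‿homo -[1+ n ] = sym (-‿involutive _)

  ⊖-homo : ∀ m n → ⟦ m ℤ.⊖ n ⟧ᶻ ≈ m · 1# - n · 1#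
  ⊖-homo m ℕ.zero = begin
    m · 1#         ≈⟨ +-identityʳ _ ⟨
    m · 1# + 0#    ≈⟨ +-congˡ -0#≈0# ⟨
    m · 1# - 0#    ∎
  ⊖-homo ℕ.zero (ℕ.suc n) = sym (+-identityˡ _)
  ⊖-homo (ℕ.suc m) (ℕ.suc n) = begin
    ⟦ ℕ.suc m ℤ.⊖ ℕ.suc n ⟧ᶻ             ≡⟨ ≡.cong ⟦_⟧ᶻ (ℤ.[1+m]⊖[1+n]≡m⊖n m n) ⟩
    ⟦ m ℤ.⊖ n ⟧ᶻ                         ≈⟨ ⊖-homo m n ⟩
    m · 1# - n · 1#                    ≈⟨ +-identityˡ _ ⟨
    0# + (m · 1# - n · 1#)             ≈⟨ +-congʳ (-‿inverseʳ 1#) ⟨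
    1# - 1# + (m · 1# - n · 1#)        ≈⟨ interchange 1# (- 1#) _ _ ⟩
    1# + m · 1# + (- 1# - n · 1#)      ≈⟨ +-congˡ (-‿+-comm 1# _) ⟩
    1# + m · 1# - (1# + n · 1#)        ≈⟨ +-cong (1+× m 1#) (-‿cong (1+× n 1#)) ⟨
    ℕ.suc m · 1# - ℕ.suc n · 1#        ∎
    where
    open import Algebra.Properties.CommutativeSemigroup
      (CommutativeRing.+-commutativeSemigroup R) using (interchange)

  +-homo : ∀ i j → ⟦ i ℤ.+ j ⟧ᶻ ≈ ⟦ i ⟧ᶻ + ⟦ j ⟧ᶻ
  +-homo (+ m)    (+ n)    = ×-homo-+ 1# m n
  +-homo (+ m)    -[1+ n ] = ⊖-homo m (ℕ.suc n)
  +-homo -[1+ m ] (+ n)    = trans (⊖-homo n (ℕ.suc m)) (+-comm _ _)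
  +-homo -[1+ m ] -[1+ n ] = begin
    - (ℕ.suc (ℕ.suc (m ℕ.+ n)) · 1#)          ≡⟨ ≡.cong (λ k → - (ℕ.suc k · 1#)) (≡.sym (ℕ.+-suc m n)) ⟩
    - ((ℕ.suc m ℕ.+ ℕ.suc n) · 1#)            ≈⟨ -‿cong (×-homo-+ 1# (ℕ.suc m) (ℕ.suc n)) ⟩
    - (ℕ.suc m · 1# + ℕ.suc n · 1#)           ≈⟨ -‿+-comm _ _ ⟨
    - (ℕ.suc m · 1#) - ℕ.suc n · 1#           ∎

  +*-homo : ∀ m j → ⟦ + m ℤ.* j ⟧ᶻ ≈ m · 1# * ⟦ j ⟧ᶻ
  +*-homo m (+ n) = begin
    ⟦ + m ℤ.* + n ⟧ᶻ    ≡⟨ ≡.cong ⟦_⟧ᶻ (ℤ.pos-* m n) ⟨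
    (m ℕ.* n) · 1#      ≈⟨ ×1-homo-* m n ⟩
    m · 1# * n · 1#     ∎
  +*-homo m -[1+ n ] = begin
    ⟦ + m ℤ.* -[1+ n ] ⟧ᶻ           ≡⟨ ≡.cong ⟦_⟧ᶻ (ℤ.neg-distribʳ-* (+ m) (+ ℕ.suc n)) ⟨
    ⟦ ℤ.- (+ m ℤ.* + ℕ.suc n) ⟧ᶻ    ≈⟨ -‿homo (+ m ℤ.* + ℕ.suc n) ⟩
    - ⟦ + m ℤ.* + ℕ.suc n ⟧ᶻ        ≈⟨ -‿cong (+*-homo m (+ ℕ.suc n)) ⟩
    - (m · 1# * ℕ.suc n · 1#)       ≈⟨ -‿distribʳ-* _ _ ⟩
    m · 1# * - (ℕ.suc n · 1#)       ∎

  *-homo : ∀ i j → ⟦ i ℤ.* j ⟧ᶻ ≈ ⟦ i ⟧ᶻ * ⟦ j ⟧ᶻ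
  *-homo (+ m)    j = +*-homo m j
  *-homo -[1+ m ] j = begin
    ⟦ -[1+ m ] ℤ.* j ⟧ᶻ             ≡⟨ ≡.cong ⟦_⟧ᶻ (ℤ.neg-distribˡ-* (+ ℕ.suc m) j) ⟨
    ⟦ ℤ.- (+ ℕ.suc m ℤ.* j) ⟧ᶻ      ≈⟨ -‿homo (+ ℕ.suc m ℤ.* j) ⟩
    - ⟦ + ℕ.suc m ℤ.* j ⟧ᶻ          ≈⟨ -‿cong (+*-homo (ℕ.suc m) j) ⟩
    - (ℕ.suc m · 1# * ⟦ j ⟧ᶻ)       ≈⟨ -‿distribˡ-* _ _ ⟩
    - (ℕ.suc m · 1#) * ⟦ j ⟧ᶻ       ∎

  homomorphism : ℤ.+-*-rawRing -Raw-AlmostCommutative⟶ fromCommutativeRing R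
  homomorphism = record
    { ⟦_⟧    = ⟦_⟧ᶻ
    ; +-homo = +-homo
    ; *-homo = *-homo
    ; -‿homo = -‿homo
    ; 0-homo = refl
    ; 1-homo = refl
    }

  private
    -- Coefficients are compared in ℤ, where equality computes, so cancelling terms vanish from
    -- normal forms in any ring. Distinct integers may still agree in the ring, hence only `Maybe`.
    _coeff≟_ : ∀ i j → Maybe (⟦ i ⟧ᶻ ≈ ⟦ j ⟧ᶻ)
    i coeff≟ j = Maybe.map (reflexive ∘ ≡.cong ⟦_⟧ᶻ) (dec⇒weaklyDec ℤ._≟_ i j)

  open import Algebra.Solver.Ring ℤ.+-*-rawRing (fromCommutativeRing R) homomorphism _coeff≟_ public
    using (solve; con; _:+_; _:*_; _:-_; :-_; _:=_)

-- Inequalities in an ordered field.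

module OrderedField {ℓ} (ℝ : CompleteOrderedField ℓ) where
  open CompleteOrderedField ℝ
  open IntegerCoefficients commutativeRing
  import Relation.Binary.Construct.NonStrictToStrict _≈_ _≤_ as Strict

  ≤-resp : ∀ {x x′ y y′} → x ≈ x′ → y ≈ y′ → x ≤ y → x′ ≤ y′
  ≤-resp x≈x′ y≈y′ x≤y = ≤.≤-respʳ-≈ y≈y′ (≤.≤-respˡ-≈ x≈x′ x≤y)

  <⇒≱ : ∀ {x y} → x < y → ¬ y ≤ x
  <⇒≱ = Strict.<⇒≱ ≤.antisym

  ≰⇒> : ∀ {x y} → ¬ x ≤ y → y < x
  ≰⇒> = Strict.≰⇒> sym ≤.reflexive ≤.total

  x≤y⇒0≤y-x : ∀ {x y} → x ≤ y → 0# ≤ y - x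
  x≤y⇒0≤y-x {x} x≤y = ≤-resp (-‿inverseʳ x) refl (+-monoˡ-≤ (- x) x≤y)

  0≤y-x⇒x≤y : ∀ {x y} → 0# ≤ y - x → x ≤ y
  0≤y-x⇒x≤y {x} {y} 0≤y-x =
    ≤-resp (+-identityˡ x) (solve 2 (λ x y → y :- x :+ x := y) refl x y) (+-monoˡ-≤ x 0≤y-x)

  -- Certificate form of an inequality: a visibly nonnegative `z`, and a ring identity equating it
  -- with the slack.
  difference-≥0⇒≤ : ∀ {x y z} → 0# ≤ z → z ≈ y - x → x ≤ y
  difference-≥0⇒≤ 0≤z z≈y-x = 0≤y-x⇒x≤y (≤-resp refl z≈y-x 0≤z)

  0<y-x⇒x<y : ∀ {x y} → 0# < y - x → x < y
  0<y-x⇒x<y {x} {y} (0≤y-x , 0≉y-x) =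
    0≤y-x⇒x≤y 0≤y-x , λ x≈y → 0≉y-x (trans (sym (-‿inverseʳ x)) (+-congʳ x≈y))

  x<y⇒0<y-x : ∀ {x y} → x < y → 0# < y - x
  x<y⇒0<y-x {x} {y} x<y =
    ≰⇒> λ y-x≤0 → <⇒≱ x<y (≤-resp (solve 2 (λ x y → y :- x :+ x := y) refl x y) (+-identityˡ x) (+-monoˡ-≤ x y-x≤0))

  0≤-+ : ∀ {x y} → 0# ≤ x → 0# ≤ y → 0# ≤ x + y
  0≤-+ {x} {y} 0≤x 0≤y = ≤.trans 0≤y (≤-resp (+-identityˡ y) refl (+-monoˡ-≤ y 0≤x))

  +-mono-≤ : ∀ {x x′ y y′} → x ≤ x′ → y ≤ y′ → x + y ≤ x′ + y′
  +-mono-≤ {x} {x′} {y} {y′} x≤x′ y≤y′ =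
    ≤.trans (+-monoˡ-≤ y x≤x′) (≤-resp (+-comm y x′) (+-comm y′ x′) (+-monoˡ-≤ x′ y≤y′))

  *-monoʳ-≤ : ∀ {x y z} → 0# ≤ z → x ≤ y → z * x ≤ z * y
  *-monoʳ-≤ {x} {y} {z} 0≤z x≤y = difference-≥0⇒≤ (*-nonNegative 0≤z (x≤y⇒0≤y-x x≤y))
    (solve 3 (λ x y z → z :* (y :- x) := z :* y :- z :* x) refl x y z)

  *-monoˡ-≤ : ∀ {x y z} → 0# ≤ z → x ≤ y → x * z ≤ y * z
  *-monoˡ-≤ 0≤z x≤y = ≤-resp (*-comm _ _) (*-comm _ _) (*-monoʳ-≤ 0≤z x≤y)

  0≤-x : ∀ {x} → x ≤ 0# → 0# ≤ - x
  0≤-x x≤0 = ≤-resp refl (+-identityˡ _) (x≤y⇒0≤y-x x≤0)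

  0≤x² : ∀ x → 0# ≤ x * x
  0≤x² x with ≤.total 0# x
  ... | inj₁ 0≤x = *-nonNegative 0≤x 0≤x
  ... | inj₂ x≤0 =
    ≤-resp refl (solve 1 (λ x → (:- x) :* (:- x) := x :* x) refl x) (*-nonNegative (0≤-x x≤0) (0≤-x x≤0))

  0<x∧0<xy⇒0<y : ∀ {x y} → 0# < x → 0# < x * y → 0# < y
  0<x∧0<xy⇒0<y (0≤x , _) 0<xy = ≰⇒> λ y≤0 → <⇒≱ 0<xy (≤-resp refl (zeroʳ _) (*-monoʳ-≤ 0≤x y≤0))

  -- The slack is `(x + 2y)²`. Used to recover a coordinate `x` from the completed-square variable
  -- `x + y`.
  square-≤ : ∀ x y → x * x ≤ ((x + y) * (x + y) + (x + y) * (x + y)) + (y * y + y * y)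
  square-≤ x y = difference-≥0⇒≤ (0≤x² (x + y + y))
    (solve 2 (λ x y → let u = x :+ y in
      (u :+ y) :* (u :+ y) := (u :* u :+ u :* u) :+ (y :* y :+ y :* y) :- x :* x) refl x y)

  0<1 : 0# < 1#
  0<1 = ≤-resp refl (*-identityˡ 1#) (0≤x² 1#) , 0≉1

  0≤x+y≤0⇒x≈0 : ∀ {x y} → 0# ≤ x → 0# ≤ y → x + y ≤ 0# → x ≈ 0#
  0≤x+y≤0⇒x≈0 {x} {y} 0≤x 0≤y x+y≤0 = ≤.antisym (≤.trans x≤x+y x+y≤0) 0≤x
    where
    x≤x+y : x ≤ x + y
    x≤x+y = difference-≥0⇒≤ 0≤y (solve 2 (λ x y → y := x :+ y :- x) refl x y)

  0≤x+x⇒0≤x : ∀ {x} → 0# ≤ x + x → 0# ≤ x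
  0≤x+x⇒0≤x {x} 0≤x+x with ≤.total 0# x
  ... | inj₁ 0≤x = 0≤x
  ... | inj₂ x≤0 = ≤.trans 0≤x+x (≤-resp refl (+-identityˡ x) (+-monoˡ-≤ x x≤0))

  x≉0⇒0<x² : ∀ {x} → ¬ x ≈ 0# → 0# < x * x
  x≉0⇒0<x² {x} x≉0 = 0≤x² x , λ 0≈x² → x≉0 (begin
    x                 ≈⟨ *-identityʳ x ⟨
    x * 1#            ≈⟨ *-congˡ (*-inverseʳ x≉0) ⟨
    x * (x * x ⁻¹)    ≈⟨ *-assoc x x (x ⁻¹) ⟨
    x * x * x ⁻¹      ≈⟨ *-congʳ 0≈x² ⟨
    0# * x ⁻¹         ≈⟨ zeroˡ _ ⟩
    0#                ∎)
    where open import Relation.Binary.Reasoning.Setoid setoid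

  x²≈0⇒x≈0 : ∀ {x} → x * x ≈ 0# → x ≈ 0#
  x²≈0⇒x≈0 {x} x²≈0 with x ≤.≟ 0#
  ... | yes x≈0 = x≈0
  ... | no  x≉0 = contradiction (sym x²≈0) (proj₂ (x≉0⇒0<x² x≉0))

  0<x⇒x≉0 : ∀ {x} → 0# < x → ¬ x ≈ 0#
  0<x⇒x≉0 (_ , 0≉x) x≈0 = 0≉x (sym x≈0)

  0<x⇒0<x⁻¹ : ∀ {x} → 0# < x → 0# < x ⁻¹
  0<x⇒0<x⁻¹ {x} 0<x = ≰⇒> λ x⁻¹≤0 → <⇒≱ 0<1
    (difference-≥0⇒≤ (*-nonNegative (proj₁ 0<x) (0≤-x x⁻¹≤0))
      (trans (solve 2 (λ x y → x :* (:- y) := con (+ 0) :- x :* y) refl x (x ⁻¹))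
             (+-congˡ (-‿cong (*-inverseʳ (0<x⇒x≉0 0<x))))))

  0<x∧0≤xy⇒0≤y : ∀ {x y} → 0# < x → 0# ≤ x * y → 0# ≤ y
  0<x∧0≤xy⇒0≤y {x} {y} 0<x 0≤xy =
    ≤-resp refl
      (trans (solve 3 (λ x y z → z :* (x :* y) := x :* z :* y) refl x y (x ⁻¹))
        (trans (*-congʳ (*-inverseʳ (0<x⇒x≉0 0<x))) (*-identityˡ y)))
      (*-nonNegative (proj₁ (0<x⇒0<x⁻¹ 0<x)) 0≤xy)

  0<x∧0<y⇒0<xy : ∀ {x y} → 0# < x → 0# < y → 0# < x * y
  0<x∧0<y⇒0<xy {x} {y} 0<x 0<y = ≰⇒> λ xy≤0 →
    <⇒≱ 0<y (0≤y-x⇒x≤y (0<x∧0≤xy⇒0≤y 0<x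
      (≤-resp refl (solve 2 (λ x y → :- (x :* y) := x :* (con (+ 0) :- y)) refl x y) (0≤-x xy≤0))))

  0<x∧0≤y⇒0<x+y : ∀ {x y} → 0# < x → 0# ≤ y → 0# < x + y
  0<x∧0≤y⇒0<x+y {x} {y} (0≤x , 0≉x) 0≤y =
    0≤-+ 0≤x 0≤y , λ 0≈x+y → 0≉x (sym (0≤x+y≤0⇒x≈0 0≤x 0≤y (≤.reflexive (sym 0≈x+y))))

  -- Ring normalisation knows nothing of inverses. An identity that holds modulo `p ≈ q`, typically
  -- `x * x ⁻¹ ≈ 1#`, is reduced to a pure ring identity by naming the cofactor `c` of `p - q`.
  linear-combination : ∀ {p q l r} c → p ≈ q → l - r ≈ c * (p - q) → l ≈ r
  linear-combination {p} {q} {l} {r} c p≈q l-r≈c[p-q] = begin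
    l                  ≈⟨ solve 2 (λ l r → l := r :+ (l :- r)) refl l r ⟩
    r + (l - r)        ≈⟨ +-congˡ l-r≈c[p-q] ⟩
    r + c * (p - q)    ≈⟨ +-congˡ (*-congˡ (trans (+-congʳ p≈q) (-‿inverseʳ q))) ⟩
    r + c * 0#         ≈⟨ solve 2 (λ r c → r :+ c :* con (+ 0) := r) refl r c ⟩
    r                  ∎
    where open import Relation.Binary.Reasoning.Setoid setoid

  <-respʳ : ∀ {x y y′} → y ≈ y′ → x < y → x < y′
  <-respʳ y≈y′ (x≤y , x≉y) = ≤-resp refl y≈y′ x≤y , λ x≈y′ → x≉y (trans x≈y′ (sym y≈y′))

  -- The witness is `1 / (2/a + p/b)`, which lies below both `a/2` and `b/p` without taking a
  -- minimum. With `d = 2b + ap` the slacks are `a²p/d` and `2b²/d`.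
  common-scale : ∀ {a b p} → 0# < a → 0# < b → 0# < p → ∃ λ η → 0# < η × η + η ≤ a × η * p ≤ b
  common-scale {a} {b} {p} 0<a 0<b 0<p = a * b * d ⁻¹ , 0<x∧0<y⇒0<xy (0<x∧0<y⇒0<xy 0<a 0<b) 0<d⁻¹ , 2η≤a , ηp≤b
    where
    d = b + b + a * p

    0<d : 0# < d
    0<d = 0<x∧0≤y⇒0<x+y (0<x∧0≤y⇒0<x+y 0<b (proj₁ 0<b)) (*-nonNegative (proj₁ 0<a) (proj₁ 0<p))

    0<d⁻¹ : 0# < d ⁻¹
    0<d⁻¹ = 0<x⇒0<x⁻¹ 0<d

    dd⁻¹≈1 : d * d ⁻¹ ≈ 1#
    dd⁻¹≈1 = *-inverseʳ (0<x⇒x≉0 0<d)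

    2η≤a : a * b * d ⁻¹ + a * b * d ⁻¹ ≤ a
    2η≤a = difference-≥0⇒≤
      (*-nonNegative (*-nonNegative (0≤x² a) (proj₁ 0<p)) (proj₁ 0<d⁻¹))
      (linear-combination a dd⁻¹≈1
        (solve 4 (λ a b p i → a :* a :* p :* i :- (a :- (a :* b :* i :+ a :* b :* i))
                           := a :* ((b :+ b :+ a :* p) :* i :- con (+ 1))) refl a b p (d ⁻¹)))

    ηp≤b : a * b * d ⁻¹ * p ≤ b
    ηp≤b = difference-≥0⇒≤
      (*-nonNegative (0≤-+ (0≤x² b) (0≤x² b)) (proj₁ 0<d⁻¹))
      (linear-combination b dd⁻¹≈1
        (solve 4 (λ a b p i → (b :* b :+ b :* b) :* i :- (b :- a :* b :* i :* p)
                           := b :* ((b :+ b :+ a :* p) :* i :- con (+ 1))) refl a b p (d ⁻¹)))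

  -- Square roots of numbers that are at least one.

  √-isSupremum : ∀ x 0≤x → IsSupremum (λ y → y * y ≤ x) (√ x 0≤x)
  √-isSupremum x 0≤x = proj₂ (supremum _ _ _)

  x²≤y²⇒x≤y : ∀ {x y} → 0# < y → x * x ≤ y * y → x ≤ y
  x²≤y²⇒x≤y {x} {y} 0<y x²≤y² with x ≤.≤? y
  ... | yes x≤y = x≤y
  ... | no  x≰y = 0≤y-x⇒x≤y (0<x∧0≤xy⇒0≤y 0<y+x (≤-resp refl
    (solve 2 (λ x y → y :* y :- x :* x := (y :+ x) :* (y :- x)) refl x y) (x≤y⇒0≤y-x x²≤y²)))
    where
    0<y+x = 0<x∧0≤y⇒0<x+y 0<y (≤.trans (proj₁ 0<y) (proj₁ (≰⇒> x≰y)))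

  -- For `1# ≤ x` the number `1#` belongs to the set whose supremum is the root. Vertex degrees here
  -- meet this condition.
  √-pos : ∀ {x} 0≤x → 1# ≤ x → 0# < √ x 0≤x
  √-pos {x} 0≤x 1≤x = ≰⇒> λ √x≤0 → <⇒≱ 0<1 (≤.trans 1≤√x √x≤0)
    where
    1≤√x : 1# ≤ √ x 0≤x
    1≤√x = proj₁ (√-isSupremum x 0≤x) (≤-resp (sym (*-identityˡ 1#)) refl 1≤x)

  -- The Newton step u = (s + x s⁻¹) / 2 satisfies x ≤ u², so it is an upper bound
  -- of the set whose supremum is s, and by the same inequality x u⁻¹ lies in that set.
  -- Then s ≤ u gives s² ≤ x and x u⁻¹ ≤ s gives x ≤ s².
  √-square : ∀ {x} 0≤x → 1# ≤ x → √ x 0≤x * √ x 0≤x ≈ x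
  √-square {x} 0≤x 1≤x = ≤.antisym s²≤x x≤s²
    where
    s = √ x 0≤x
    ½ = (1# + 1#) ⁻¹
    w = x * s ⁻¹
    u = (s + w) * ½
    v = x * u ⁻¹

    0<s : 0# < s
    0<s = √-pos 0≤x 1≤x

    0<2 : 0# < 1# + 1#
    0<2 = 0<x∧0≤y⇒0<x+y 0<1 (proj₁ 0<1)

    2½≈1 : (1# + 1#) * ½ ≈ 1#
    2½≈1 = *-inverseʳ (0<x⇒x≉0 0<2)

    ss⁻¹≈1 : s * s ⁻¹ ≈ 1#
    ss⁻¹≈1 = *-inverseʳ (0<x⇒x≉0 0<s)

    sw≈x : s * w ≈ x
    sw≈x = linear-combination x ss⁻¹≈1
      (solve 3 (λ x s i → s :* (x :* i) :- x := x :* (s :* i :- con (+ 1))) refl x s (s ⁻¹))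

    0<u : 0# < u
    0<u = 0<x∧0<y⇒0<xy
      (0<x∧0≤y⇒0<x+y 0<s (*-nonNegative 0≤x (proj₁ (0<x⇒0<x⁻¹ 0<s)))) (0<x⇒0<x⁻¹ 0<2)

    uu⁻¹≈1 : u * u ⁻¹ ≈ 1#
    uu⁻¹≈1 = *-inverseʳ (0<x⇒x≉0 0<u)

    x≤u² : x ≤ u * u
    x≤u² = difference-≥0⇒≤ (0≤x² ((s - w) * ½)) (sym (trans
      (+-congˡ (-‿cong (sym sw≈x)))
      (linear-combination (s * w * ((1# + 1#) * ½ + 1#)) 2½≈1
        (solve 3 (λ s w h → let 1ᵖ = con (+ 1) ; 2ᵖ = 1ᵖ :+ 1ᵖ in
             (s :+ w) :* h :* ((s :+ w) :* h) :- s :* w :- (s :- w) :* h :* ((s :- w) :* h)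
          := s :* w :* (2ᵖ :* h :+ 1ᵖ) :* (2ᵖ :* h :- 1ᵖ)) refl s w ½))))

    s≤u : s ≤ u
    s≤u = proj₂ (√-isSupremum x 0≤x) u λ y²≤x → x²≤y²⇒x≤y 0<u (≤.trans y²≤x x≤u²)

    v²≤x : v * v ≤ x
    v²≤x = difference-≥0⇒≤
      (*-nonNegative 0≤x (*-nonNegative (0≤x² (u ⁻¹)) (x≤y⇒0≤y-x x≤u²)))
      (linear-combination (x * (u * u ⁻¹ + 1#)) uu⁻¹≈1
        (solve 3 (λ x u i → let 1ᵖ = con (+ 1) in
             x :* (i :* i :* (u :* u :- x)) :- (x :- x :* i :* (x :* i))
          := x :* (u :* i :+ 1ᵖ) :* (u :* i :- 1ᵖ)) refl x u (u ⁻¹)))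

    v≤s : v ≤ s
    v≤s = proj₁ (√-isSupremum x 0≤x) v²≤x

    -- `s * u` is the mean of `s²` and `x`, so comparing it with either one compares the two.
    2su≈s²+x : (1# + 1#) * (s * u) ≈ s * s + x
    2su≈s²+x = trans
      (linear-combination (s * (s + w)) 2½≈1
        (solve 3 (λ s w h → let 1ᵖ = con (+ 1) ; 2ᵖ = 1ᵖ :+ 1ᵖ in
          2ᵖ :* (s :* ((s :+ w) :* h)) :- (s :* s :+ s :* w) := s :* (s :+ w) :* (2ᵖ :* h :- 1ᵖ))
          refl s w ½))
      (+-congˡ sw≈x)

    s²≤x : s * s ≤ x
    s²≤x = difference-≥0⇒≤
      (*-nonNegative (proj₁ 0<2) (*-nonNegative (proj₁ 0<s) (x≤y⇒0≤y-x s≤u)))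
      (linear-combination 1# 2su≈s²+x
        (solve 3 (λ x s u → let 1ᵖ = con (+ 1) ; 2ᵖ = 1ᵖ :+ 1ᵖ in
             2ᵖ :* (s :* (u :- s)) :- (x :- s :* s)
          := 1ᵖ :* (2ᵖ :* (s :* u) :- (s :* s :+ x))) refl x s u))

    x≤su : x ≤ s * u
    x≤su = difference-≥0⇒≤ (*-nonNegative (proj₁ 0<u) (x≤y⇒0≤y-x v≤s))
      (linear-combination (- x) uu⁻¹≈1
        (solve 4 (λ x s u i →
             u :* (s :- x :* i) :- (s :* u :- x) := (:- x) :* (u :* i :- con (+ 1)))
          refl x s u (u ⁻¹)))

    x≤s² : x ≤ s * s
    x≤s² = difference-≥0⇒≤ (*-nonNegative (proj₁ 0<2) (x≤y⇒0≤y-x x≤su))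
      (linear-combination 1# 2su≈s²+x
        (solve 3 (λ x s u → let 1ᵖ = con (+ 1) ; 2ᵖ = 1ᵖ :+ 1ᵖ in
             2ᵖ :* (s :* u :- x) :- (s :* s :- x)
          := 1ᵖ :* (2ᵖ :* (s :* u) :- (s :* s :+ x))) refl x s u))

-- Bilinear algebra and crude bounds for quadratic forms.

module QuadraticForms {ℓ} (ℝ : CompleteOrderedField ℓ) where
  open CompleteOrderedField ℝ hiding (zero)
  open Matrices ℝ
  open OrderedField ℝ
  open IntegerCoefficients commutativeRing
  open import Algebra.Properties.Semiring.Sum semiring
    using (sum; sum-cong-≋; sum-replicate-zero; *-distribˡ-sum)
  open import Relation.Binary.Reasoning.Setoid setoid

  infixl 7 _∙_

  _∙_ : ∀ {n} → Vector Carrier n → Vector Carrier n → Carrier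
  x ∙ y = sum λ i → x i * y i

  form : ∀ {n} → Matrix n → Vector Carrier n → Carrier
  form M x = x ∙ (M ⊗ᵥ x)

  -- Additivity, scaling and subtraction are all drawn from this two-term shape; hence the padding
  -- by `0#`, `1#` and `- 1#` in later calculations.
  sum-linear : ∀ {n} a b (f g : Vector Carrier n) →
               sum (λ i → a * f i + b * g i) ≈ a * sum f + b * sum g
  sum-linear {ℕ.zero}  a b f g = solve 2 (λ a b → con (+ 0) := a :* con (+ 0) :+ b :* con (+ 0)) refl a b
  sum-linear {ℕ.suc n} a b f g = trans (+-congˡ (sum-linear a b (f ∘ suc) (g ∘ suc)))
    (solve 6 (λ a b f₀ g₀ f g → a :* f₀ :+ b :* g₀ :+ (a :* f :+ b :* g) := a :* (f₀ :+ f) :+ b :* (g₀ :+ g))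
      refl a b (f zero) (g zero) (sum (f ∘ suc)) (sum (g ∘ suc)))

  ∙-congˡ : ∀ {n} (x : Vector Carrier n) {y z} → (∀ i → y i ≈ z i) → x ∙ y ≈ x ∙ z
  ∙-congˡ x y≈z = sum-cong-≋ (λ i → *-congˡ (y≈z i))

  ∙-congʳ : ∀ {n} {x y : Vector Carrier n} z → (∀ i → x i ≈ y i) → x ∙ z ≈ y ∙ z
  ∙-congʳ z x≈y = sum-cong-≋ (λ i → *-congʳ (x≈y i))

  ∙-comm : ∀ {n} (x y : Vector Carrier n) → x ∙ y ≈ y ∙ x
  ∙-comm x y = sum-cong-≋ (λ i → *-comm (x i) (y i))

  ∙-linearʳ : ∀ {n} a b (x y z : Vector Carrier n) →
              x ∙ (λ i → a * y i + b * z i) ≈ a * (x ∙ y) + b * (x ∙ z)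
  ∙-linearʳ a b x y z = trans
    (sum-cong-≋ λ i → solve 5 (λ a b x y z → x :* (a :* y :+ b :* z) := a :* (x :* y) :+ b :* (x :* z))
                        refl a b (x i) (y i) (z i))
    (sum-linear a b (λ i → x i * y i) (λ i → x i * z i))

  ∙-linearˡ : ∀ {n} a b (x y z : Vector Carrier n) →
              (λ i → a * x i + b * y i) ∙ z ≈ a * (x ∙ z) + b * (y ∙ z)
  ∙-linearˡ a b x y z = trans (∙-comm _ z)
    (trans (∙-linearʳ a b z x y) (+-cong (*-congˡ (∙-comm z x)) (*-congˡ (∙-comm z y))))

  form-cong : ∀ {n} {M N : Matrix n} x → (∀ i j → M i j ≈ N i j) → form M x ≈ form N x
  form-cong x M≈N = ∙-congˡ x (λ i → ∙-congʳ x (M≈N i))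

  form-congʳ : ∀ {n} (M : Matrix n) {x y} → (∀ i → x i ≈ y i) → form M x ≈ form M y
  form-congʳ M {x} {y} x≈y = trans (∙-congʳ (M ⊗ᵥ x) x≈y) (∙-congˡ y (λ i → ∙-congˡ (M i) x≈y))

  form-linear : ∀ {n} {M N P : Matrix n} a b x → (∀ i j → P i j ≈ a * M i j + b * N i j) →
                form P x ≈ a * form M x + b * form N x
  form-linear {M = M} {N} a b x P≈aM+bN = trans (form-cong x P≈aM+bN)
    (trans (∙-congˡ x (λ i → ∙-linearˡ a b (M i) (N i) x)) (∙-linearʳ a b x (M ⊗ᵥ x) (N ⊗ᵥ x)))

  form-eigenvector : ∀ {n} (M : Matrix n) {μ} x → (∀ i → (M ⊗ᵥ x) i ≈ μ * x i) → form M x ≈ μ * (x ∙ x)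
  form-eigenvector M {μ} x Mx≈μx = begin
    form M x                         ≈⟨ ∙-congˡ x Mx≈μx ⟩
    x ∙ (λ i → μ * x i)
      ≈⟨ ∙-congˡ x (λ i → solve 2 (λ μ x → μ :* x := μ :* x :+ con (+ 0) :* x) refl μ (x i)) ⟩
    x ∙ (λ i → μ * x i + 0# * x i)   ≈⟨ ∙-linearʳ μ 0# x x x ⟩
    μ * (x ∙ x) + 0# * (x ∙ x)       ≈⟨ solve 2 (λ μ q → μ :* q :+ con (+ 0) :* q := μ :* q) refl μ (x ∙ x) ⟩
    μ * (x ∙ x)                      ∎

  0≤x∙x : ∀ {n} (x : Vector Carrier n) → 0# ≤ x ∙ x
  0≤x∙x {ℕ.zero}  x = ≤.refl
  0≤x∙x {ℕ.suc n} x = 0≤-+ (0≤x² (x zero)) (0≤x∙x (x ∘ suc))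

  x∙x≤0⇒x≈0 : ∀ {n} (x : Vector Carrier n) → x ∙ x ≤ 0# → ∀ i → x i ≈ 0#
  x∙x≤0⇒x≈0 x x∙x≤0 zero    = x²≈0⇒x≈0 (0≤x+y≤0⇒x≈0 (0≤x² (x zero)) (0≤x∙x (x ∘ suc)) x∙x≤0)
  x∙x≤0⇒x≈0 x x∙x≤0 (suc i) = x∙x≤0⇒x≈0 (x ∘ suc)
    (≤.reflexive (0≤x+y≤0⇒x≈0 (0≤x∙x (x ∘ suc)) (0≤x² (x zero)) (≤-resp (+-comm _ _) refl x∙x≤0))) i

  diagonal-∙ : ∀ {n} (d : Vector Carrier n) i x → diagonal d i ∙ x ≈ d i * x i
  diagonal-∙ {ℕ.suc n} d zero x = begin
    d zero * x zero + sum (λ j → 0# * x (suc j))   ≈⟨ +-congˡ (sum-cong-≋ (λ j → zeroˡ (x (suc j)))) ⟩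
    d zero * x zero + sum {n} (λ _ → 0#)           ≈⟨ +-congˡ (sum-replicate-zero n) ⟩
    d zero * x zero + 0#                           ≈⟨ +-identityʳ _ ⟩
    d zero * x zero                                ∎
  diagonal-∙ d (suc i) x = begin
    0# * x zero + diagonal (d ∘ suc) i ∙ (x ∘ suc)  ≈⟨ +-cong (zeroˡ _) (diagonal-∙ (d ∘ suc) i (x ∘ suc)) ⟩
    0# + d (suc i) * x (suc i)                      ≈⟨ +-identityˡ _ ⟩
    d (suc i) * x (suc i)                           ∎

  diagonal-sym : ∀ {n} (d : Vector Carrier n) i j → diagonal d i j ≈ diagonal d j i
  diagonal-sym d zero    zero    = refl
  diagonal-sym d zero    (suc j) = refl
  diagonal-sym d (suc i) zero    = refl
  diagonal-sym d (suc i) (suc j) = diagonal-sym (d ∘ suc) i j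

  δ : ∀ {n} → Fin n → Vector Carrier n
  δ = diagonal (λ _ → 1#)

  δ-∙ : ∀ {n} i (x : Vector Carrier n) → δ i ∙ x ≈ x i
  δ-∙ i x = trans (diagonal-∙ (λ _ → 1#) i x) (*-identityˡ (x i))

  ⊗ᵥ-δ : ∀ {n} (M : Matrix n) i j → (M ⊗ᵥ δ j) i ≈ M i j
  ⊗ᵥ-δ M i j = trans (∙-comm (M i) (δ j)) (δ-∙ j (M i))

  form-δ : ∀ {n} (M : Matrix n) i → form M (δ i) ≈ M i i
  form-δ M i = trans (δ-∙ i (M ⊗ᵥ δ i)) (⊗ᵥ-δ M i i)

  -- A weak Cauchy-Schwarz inequality: any constant will do, so `(a + b)² ≤ 2a² + 2b²` is applied
  -- coordinate by coordinate, and the constant doubles each time.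
  ∙-bounded : ∀ {n} (c : Vector Carrier n) →
              ∃ λ K → 0# ≤ K × (∀ x → (c ∙ x) * (c ∙ x) ≤ K * (x ∙ x))
  ∙-bounded {ℕ.zero}  c = 0# , ≤.refl , λ x → ≤.refl
  ∙-bounded {ℕ.suc n} c with ∙-bounded (c ∘ suc)
  ... | K , 0≤K , bound = K′ + K′ , 0≤-+ 0≤K′ 0≤K′ , λ x →
      let c₀ = c zero ; x₀ = x zero ; x′ = x ∘ suc ; r = (c ∘ suc) ∙ x′ ; q = x′ ∙ x′
          0≤Kq-r² = x≤y⇒0≤y-x (bound x′)
          0≤c₀²q = *-nonNegative (0≤x² c₀) (0≤x∙x x′)
          0≤Kx₀² = *-nonNegative 0≤K (0≤x² x₀)
          half = 0≤-+ 0≤Kq-r² (0≤-+ 0≤c₀²q 0≤Kx₀²)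
      in difference-≥0⇒≤ (0≤-+ (0≤x² (c₀ * x₀ - r)) (0≤-+ half half))
           (solve 5 (λ c x r q k →
                let h = k :* q :- r :* r :+ (c :* c :* q :+ k :* (x :* x)) ; k′ = k :+ c :* c in
                (c :* x :- r) :* (c :* x :- r) :+ (h :+ h)
             := (k′ :+ k′) :* (x :* x :+ q) :- (c :* x :+ r) :* (c :* x :+ r))
             refl c₀ x₀ r q K)
    where
    K′ = K + c zero * c zero
    0≤K′ = 0≤-+ 0≤K (0≤x² (c zero))

  -- Rectangular, so that the induction can drop a row and keep the columns.
  rows-bounded : ∀ {m n} (M : Fin m → Vector Carrier n) →
                 ∃ λ K → ∀ x → (λ i → M i ∙ x) ∙ (λ i → M i ∙ x) ≤ K * (x ∙ x)
  rows-bounded {ℕ.zero}  M = 0# , λ x → ≤.reflexive (sym (zeroˡ (x ∙ x)))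
  rows-bounded {ℕ.suc m} M with ∙-bounded (M zero) | rows-bounded (M ∘ suc)
  ... | K , _ , bound | L , bound′ = K + L , λ x →
    difference-≥0⇒≤ (0≤-+ (x≤y⇒0≤y-x (bound x)) (x≤y⇒0≤y-x (bound′ x)))
      (solve 5 (λ k l q a b → k :* q :- a :+ (l :* q :- b) := (k :+ l) :* q :- (a :+ b)) refl K L (x ∙ x) _ _)

  0≤∥x+y∥² : ∀ {n} (x y : Vector Carrier n) → 0# ≤ (x ∙ x + y ∙ y) + (x ∙ y + x ∙ y)
  0≤∥x+y∥² {ℕ.zero}  x y = 0≤-+ (0≤-+ ≤.refl ≤.refl) (0≤-+ ≤.refl ≤.refl)
  0≤∥x+y∥² {ℕ.suc n} x y = ≤-resp refl
    (solve 5 (λ x y p q r →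
         (x :+ y) :* (x :+ y) :+ ((p :+ q) :+ (r :+ r))
      := ((x :* x :+ p) :+ (y :* y :+ q)) :+ ((x :* y :+ r) :+ (x :* y :+ r))) refl
      (x zero) (y zero) (x′ ∙ x′) (y′ ∙ y′) (x′ ∙ y′))
    (0≤-+ (0≤x² (x zero + y zero)) (0≤∥x+y∥² x′ y′))
    where
    x′ = x ∘ suc
    y′ = y ∘ suc

  -- Expanding `0 ≤ |x + Mx|²` gives `2 xᵀMx ≥ - (K + 1) |x|²`. The chosen constant is twice as low
  -- as this requires, which avoids a division by two.
  form-boundedBelow : ∀ {n} (M : Matrix n) → ∃ λ t → ∀ x → t * (x ∙ x) ≤ form M x
  form-boundedBelow M with rows-bounded M
  ... | K , bound = - K - 1# , λ x →
    let q = x ∙ x ; w = (M ⊗ᵥ x) ∙ (M ⊗ᵥ x)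
        0≤Kq = ≤.trans (0≤x∙x (M ⊗ᵥ x)) (bound x)
    in 0≤y-x⇒x≤y (0≤x+x⇒0≤x (≤-resp refl
      (solve 4 (λ K q w f →
           q :+ w :+ (f :+ f) :+ ((K :* q :- w) :+ (K :* q :+ q))
        := (f :- (:- K :- con (+ 1)) :* q) :+ (f :- (:- K :- con (+ 1)) :* q)) refl K q w (form M x))
      (0≤-+ (0≤∥x+y∥² x (M ⊗ᵥ x)) (0≤-+ (x≤y⇒0≤y-x (bound x)) (0≤-+ 0≤Kq (0≤x∙x x))))))

  -- The alternative between a kernel and coercivity.

  Kernel : ∀ {n} → Matrix n → Pred (Vector Carrier n) ℓ
  Kernel M x = ¬ (∀ i → x i ≈ 0#) × (∀ i → (M ⊗ᵥ x) i ≈ 0#)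

  Coercive : ∀ {n} → Matrix n → Set ℓ
  Coercive M = ∃ λ ε → 0# < ε × (∀ x → ε * (x ∙ x) ≤ form M x)

  0≤tp+κ⇒p≈0 : ∀ p κ → (∀ t → 0# ≤ t * p + κ) → p ≈ 0#
  0≤tp+κ⇒p≈0 p κ bound with p ≤.≟ 0#
  ... | yes p≈0 = p≈0
  ... | no  p≉0 = contradiction 1≤0 (<⇒≱ 0<1)
    where
    1≤0 : 1# ≤ 0#
    -- At this `t` the affine function takes the value `- 1#`.
    1≤0 = difference-≥0⇒≤ (bound (- (κ + 1#) * p ⁻¹)) (linear-combination (- (κ + 1#)) (*-inverseʳ p≉0)
      (solve 3 (λ κ p i → let 1ᵖ = con (+ 1) in
           (:- (κ :+ 1ᵖ)) :* i :* p :+ κ :- (con (+ 0) :- 1ᵖ) := (:- (κ :+ 1ᵖ)) :* (p :* i :- 1ᵖ))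
        refl κ p (p ⁻¹)))

  -- Let `b` be the column below the vanishing pivot. On `t ∷ b` the form is affine in `t` with
  -- slope `2 |b|²`; being nonnegative for all `t`, it must have slope zero.
  column≈0 : ∀ {n} (M : Matrix (ℕ.suc n)) → PositiveSemidefinite M → M zero zero ≈ 0# → ∀ i → M i zero ≈ 0#
  column≈0 M _ M₀₀≈0 zero = M₀₀≈0
  column≈0 {n} M (M-sym , 0≤M) M₀₀≈0 (suc i) = x∙x≤0⇒x≈0 b (≤.reflexive b∙b≈0) i
    where
    b : Vector Carrier n
    b i = M (suc i) zero

    C : Matrix n
    C i j = M (suc i) (suc j)

    form≈ : ∀ t → form M (t ∷ b) ≈ t * (b ∙ b + b ∙ b) + form C b
    form≈ t = begin
      t * (M zero zero * t + (M zero ∘ suc) ∙ b) + b ∙ (λ i → b i * t + (C ⊗ᵥ b) i)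
        ≈⟨ +-cong
             (*-congˡ (+-cong (*-congʳ M₀₀≈0) (∙-congʳ b (λ j → M-sym zero (suc j)))))
             (trans (∙-congˡ b (λ i → solve 3 (λ b t c → b :* t :+ c := t :* b :+ con (+ 1) :* c) refl (b i) t ((C ⊗ᵥ b) i)))
                    (∙-linearʳ t 1# b b (C ⊗ᵥ b))) ⟩
      t * (0# * t + b ∙ b) + (t * (b ∙ b) + 1# * form C b)
        ≈⟨ solve 3 (λ t β κ → t :* (con (+ 0) :* t :+ β) :+ (t :* β :+ con (+ 1) :* κ) := t :* (β :+ β) :+ κ)
             refl t (b ∙ b) (form C b) ⟩
      t * (b ∙ b + b ∙ b) + form C b
        ∎

    b∙b≈0 : b ∙ b ≈ 0#
    b∙b≈0 = 0≤x+y≤0⇒x≈0 (0≤x∙x b) (0≤x∙x b)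
      (≤.reflexive (0≤tp+κ⇒p≈0 (b ∙ b + b ∙ b) (form C b) (λ t → ≤-resp refl (form≈ t) (0≤M (t ∷ b)))))

  -- For c the first column of M below the diagonal divided by a = M₀₀,
  -- xᵀMx = a (x₀ + c·y)² + yᵀSy, where y is the tail of x.
  module SchurComplement {n} (M : Matrix (ℕ.suc n)) (M-sym : ∀ i j → M i j ≈ M j i)
                         (a≉0 : ¬ M zero zero ≈ 0#) where

    a : Carrier
    a = M zero zero

    c : Vector Carrier n
    c i = a ⁻¹ * M (suc i) zero

    S : Matrix n
    S i j = M (suc i) (suc j) - a * c i * c j

    S-sym : ∀ i j → S i j ≈ S j i
    S-sym i j = +-cong (M-sym (suc i) (suc j))
      (-‿cong (solve 3 (λ a x y → a :* x :* y := a :* y :* x) refl a (c i) (c j)))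

    a*c≈ : ∀ i → M (suc i) zero ≈ a * c i
    a*c≈ i = sym (linear-combination (M (suc i) zero) (*-inverseʳ a≉0)
      (solve 3 (λ a i m → a :* (i :* m) :- m := m :* (a :* i :- con (+ 1))) refl a (a ⁻¹) (M (suc i) zero)))

    ⊗ᵥ-zero : ∀ x → (M ⊗ᵥ x) zero ≈ a * (x zero + c ∙ (x ∘ suc))
    ⊗ᵥ-zero x = begin
      a * x zero + (M zero ∘ suc) ∙ y
        ≈⟨ +-congˡ (∙-congʳ y (λ j → trans (M-sym zero (suc j)) (trans (a*c≈ j)
             (solve 2 (λ a c → a :* c := a :* c :+ con (+ 0) :* c) refl a (c j))))) ⟩
      a * x zero + (λ j → a * c j + 0# * c j) ∙ y
        ≈⟨ +-congˡ (∙-linearˡ a 0# c c y) ⟩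
      a * x zero + (a * (c ∙ y) + 0# * (c ∙ y))
        ≈⟨ solve 3 (λ a x γ → a :* x :+ (a :* γ :+ con (+ 0) :* γ) := a :* (x :+ γ)) refl a (x zero) (c ∙ y) ⟩
      a * (x zero + c ∙ y)
        ∎
      where y = x ∘ suc

    ⊗ᵥ-suc : ∀ x i → (M ⊗ᵥ x) (suc i) ≈ a * (x zero + c ∙ (x ∘ suc)) * c i + 1# * (S ⊗ᵥ (x ∘ suc)) i
    ⊗ᵥ-suc x i = begin
      M (suc i) zero * x zero + (M (suc i) ∘ suc) ∙ y
        ≈⟨ +-cong (*-congʳ (a*c≈ i)) (∙-congʳ y (λ j →
             solve 4 (λ a ci cj m → m := a :* ci :* cj :+ con (+ 1) :* (m :- a :* ci :* cj)) refl a (c i) (c j) (M (suc i) (suc j)))) ⟩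
      a * c i * x zero + (λ j → a * c i * c j + 1# * S i j) ∙ y
        ≈⟨ +-congˡ (∙-linearˡ (a * c i) 1# c (S i) y) ⟩
      a * c i * x zero + (a * c i * (c ∙ y) + 1# * (S i ∙ y))
        ≈⟨ solve 5 (λ a ci x γ s → a :* ci :* x :+ (a :* ci :* γ :+ con (+ 1) :* s) := a :* (x :+ γ) :* ci :+ con (+ 1) :* s)
             refl a (c i) (x zero) (c ∙ y) (S i ∙ y) ⟩
      a * (x zero + c ∙ y) * c i + 1# * (S i ∙ y)
        ∎
      where y = x ∘ suc

    form≈ : ∀ x → form M x ≈ a * ((x zero + c ∙ (x ∘ suc)) * (x zero + c ∙ (x ∘ suc))) + form S (x ∘ suc)
    form≈ x = begin
      x zero * (M ⊗ᵥ x) zero + y ∙ ((M ⊗ᵥ x) ∘ suc)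
        ≈⟨ +-cong (*-congˡ (⊗ᵥ-zero x)) (∙-congˡ y (⊗ᵥ-suc x)) ⟩
      x zero * (a * u) + y ∙ (λ i → a * u * c i + 1# * (S ⊗ᵥ y) i)
        ≈⟨ +-congˡ (trans (∙-linearʳ (a * u) 1# y c (S ⊗ᵥ y)) (+-congʳ (*-congˡ (∙-comm y c)))) ⟩
      x zero * (a * u) + (a * u * (c ∙ y) + 1# * form S y)
        ≈⟨ solve 4 (λ a x γ f → let u = x :+ γ in
                      x :* (a :* u) :+ (a :* u :* γ :+ con (+ 1) :* f) := a :* (u :* u) :+ f)
             refl a (x zero) (c ∙ y) (form S y) ⟩
      a * (u * u) + form S y
        ∎
      where
      y = x ∘ suc
      u = x zero + c ∙ y

    -- The head makes the completed square vanish; for a positive pivot it minimises the form among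
    -- vectors with tail `y`.
    lift : Vector Carrier n → Vector Carrier (ℕ.suc n)
    lift y = - (c ∙ y) ∷ y

    form-lift : ∀ y → form M (lift y) ≈ form S y
    form-lift y = trans (form≈ (lift y))
      (solve 3 (λ a γ f → a :* ((:- γ :+ γ) :* (:- γ :+ γ)) :+ f := f) refl a (c ∙ y) (form S y))

    S-psd : (∀ x → 0# ≤ form M x) → PositiveSemidefinite S
    S-psd 0≤M = S-sym , λ y → ≤-resp refl (form-lift y) (0≤M (lift y))

    lift-kernel : ∀ {y} → Kernel S y → Kernel M (lift y)
    lift-kernel {y} (y≉0 , Sy≈0) = (λ x≈0 → y≉0 (x≈0 ∘ suc)) , λ where
      zero    → trans (⊗ᵥ-zero (lift y)) (solve 2 (λ a γ → a :* (:- γ :+ γ) := con (+ 0)) refl a (c ∙ y))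
      (suc i) → trans (⊗ᵥ-suc (lift y) i) (trans (+-congˡ (*-congˡ (Sy≈0 i)))
        (solve 3 (λ a γ ci → a :* (:- γ :+ γ) :* ci :+ con (+ 1) :* con (+ 0) := con (+ 0)) refl a (c ∙ y) (c i)))

    -- With `u = x₀ + c·y`, `square-≤` gives `|x|² ≤ 2u² + (2K + 1) |y|²`. The two conditions on `η`
    -- let `a u²` absorb the first term and `ε |y|²` the second.
    coercive-bound : ∀ {ε η K} → (∀ y → (c ∙ y) * (c ∙ y) ≤ K * (y ∙ y)) → (∀ y → ε * (y ∙ y) ≤ form S y) →
                     0# ≤ η → η + η ≤ a → η * (K + K + 1#) ≤ ε → ∀ x → η * (x ∙ x) ≤ form M x
    coercive-bound {ε} {η} {K} c-bound ε-bound 0≤η 2η≤a ηP≤ε x =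
      ≤.trans (*-monoʳ-≤ 0≤η x∙x≤)
        (≤-resp (η-split η K (u * u) q) (sym (form≈ x))
          (+-mono-≤ (*-monoˡ-≤ (0≤x² u) 2η≤a) (≤.trans (*-monoˡ-≤ (0≤x∙x y) ηP≤ε) (ε-bound y))))
      where
      y = x ∘ suc
      u = x zero + c ∙ y
      q = y ∙ y

      x∙x≤ : x ∙ x ≤ (u * u + u * u) + (K + K + 1#) * q
      x∙x≤ = ≤-resp refl
        (solve 3 (λ U K q → (U :+ U) :+ (K :* q :+ K :* q) :+ q := (U :+ U) :+ (K :+ K :+ con (+ 1)) :* q)
          refl (u * u) K q)
        (+-monoˡ-≤ q (≤.trans (square-≤ (x zero) (c ∙ y))
          (+-mono-≤ ≤.refl (+-mono-≤ (c-bound y) (c-bound y)))))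

      η-split : ∀ η K U q → (η + η) * U + η * (K + K + 1#) * q ≈ η * ((U + U) + (K + K + 1#) * q)
      η-split = solve 4 (λ η K U q → let P = K :+ K :+ con (+ 1) in
        (η :+ η) :* U :+ η :* P :* q := η :* ((U :+ U) :+ P :* q)) refl

    lift-coercive : 0# < a → Coercive S → Coercive M
    lift-coercive 0<a (ε , 0<ε , ε-bound) =
      let K , 0≤K , c-bound = ∙-bounded c
          0<P = <-respʳ (+-comm 1# (K + K)) (0<x∧0≤y⇒0<x+y 0<1 (0≤-+ 0≤K 0≤K))
          η , 0<η , 2η≤a , ηP≤ε = common-scale 0<a 0<ε 0<P
      in η , 0<η , coercive-bound c-bound ε-bound (proj₁ 0<η) 2η≤a ηP≤ε

  -- Induction on the dimension. A zero pivot forces a zero column, so the first basis vector is in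
  -- the kernel; otherwise the pivot is positive and either alternative lifts from the Schur
  -- complement.
  kernel-or-coercive : ∀ {n} (M : Matrix n) → PositiveSemidefinite M → ∃ (Kernel M) ⊎ Coercive M
  kernel-or-coercive {ℕ.zero}  M _ = inj₂ (1# , 0<1 , λ x → ≤.reflexive (zeroʳ 1#))
  kernel-or-coercive {ℕ.suc n} M M-psd@(M-sym , 0≤M) with M zero zero ≤.≟ 0#
  ... | yes a≈0 = inj₁
    (δ zero , (λ δ≈0 → 0≉1 (sym (δ≈0 zero))) , λ i → trans (⊗ᵥ-δ M i zero) (column≈0 M M-psd a≈0 i))
  ... | no  a≉0 = lift-alternative (kernel-or-coercive S (S-psd 0≤M))
    where
    open SchurComplement M M-sym a≉0

    0<a : 0# < M zero zero
    0<a = ≤-resp refl (form-δ M zero) (0≤M (δ zero)) , λ 0≈a → a≉0 (sym 0≈a)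

    lift-alternative : ∃ (Kernel S) ⊎ Coercive S → ∃ (Kernel M) ⊎ Coercive M
    lift-alternative (inj₁ (y , y∈kerS)) = inj₁ (lift y , lift-kernel y∈kerS)
    lift-alternative (inj₂ S-coercive)   = inj₂ (lift-coercive 0<a S-coercive)

  -- Diagonal congruence and test vectors.

  form-congruence : ∀ {n} {M N : Matrix n} (d : Vector Carrier n) → (∀ i j → N i j ≈ d i * M i j * d j) →
                    ∀ x → form N x ≈ form M (λ i → d i * x i)
  form-congruence {M = M} {N} d N≈dMd x = begin
    x ∙ (N ⊗ᵥ x)                                      ≈⟨ ∙-congˡ x row ⟩
    x ∙ (λ i → d i * (M ⊗ᵥ (λ j → d j * x j)) i)      ≈⟨ sum-cong-≋ (λ i →
      solve 3 (λ d x w → x :* (d :* w) := d :* x :* w) refl (d i) (x i) _) ⟩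
    form M (λ i → d i * x i)                          ∎
    where
    row : ∀ i → (N ⊗ᵥ x) i ≈ d i * (M ⊗ᵥ (λ j → d j * x j)) i
    row i = trans
      (sum-cong-≋ λ j → trans (*-congʳ (N≈dMd i j))
        (solve 4 (λ a m b x → a :* m :* b :* x := a :* (m :* (b :* x))) refl (d i) (M i j) (d j) (x j)))
      (sym (*-distribˡ-sum (d i) (λ j → M i j * (d j * x j))))

  diagonal-⊗-diagonal : ∀ {n} (d : Vector Carrier n) (M : Matrix n) i j →
                        (diagonal d ⊗ M ⊗ diagonal d) i j ≈ d i * M i j * d j
  diagonal-⊗-diagonal d M i j = begin
    (diagonal d ⊗ M) i ∙ (λ k → diagonal d k j)   ≈⟨ ∙-congʳ _ (λ k → diagonal-∙ d i (λ l → M l k)) ⟩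
    (λ k → d i * M i k) ∙ (λ k → diagonal d k j)  ≈⟨ ∙-congˡ _ (λ k → diagonal-sym d k j) ⟩
    (λ k → d i * M i k) ∙ diagonal d j            ≈⟨ ∙-comm _ (diagonal d j) ⟩
    diagonal d j ∙ (λ k → d i * M i k)            ≈⟨ diagonal-∙ d j (λ k → d i * M i k) ⟩
    d j * (d i * M i j)                           ≈⟨ *-comm _ _ ⟩
    d i * M i j * d j                             ∎

  form-diagonal : ∀ {n} (d : Vector Carrier n) x → form (diagonal d) x ≈ x ∙ (λ i → d i * x i)
  form-diagonal d x = ∙-congˡ x (λ i → diagonal-∙ d i x)

  -- For a symmetric matrix with zero diagonal the value is `- 2 M i j`, so a positive entry yields
  -- a negative value of the form.
  form-δ-δ : ∀ {n} (M : Matrix n) i j →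
             form M (λ k → 1# * δ i k + - 1# * δ j k) ≈ M i i - M i j - (M j i - M j j)
  form-δ-δ M i j = begin
    (λ k → 1# * δ i k + - 1# * δ j k) ∙ (M ⊗ᵥ (λ k → 1# * δ i k + - 1# * δ j k))
      ≈⟨ ∙-congˡ _ (λ k → trans (∙-linearʳ 1# (- 1#) (M k) (δ i) (δ j))
                                (+-cong (*-congˡ (⊗ᵥ-δ M k i)) (*-congˡ (⊗ᵥ-δ M k j)))) ⟩
    (λ k → 1# * δ i k + - 1# * δ j k) ∙ g
      ≈⟨ ∙-linearˡ 1# (- 1#) (δ i) (δ j) g ⟩
    1# * (δ i ∙ g) + - 1# * (δ j ∙ g)
      ≈⟨ +-cong (*-congˡ (δ-∙ i g)) (*-congˡ (δ-∙ j g)) ⟩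
    1# * g i + - 1# * g j
      ≈⟨ solve 4 (λ a b c d → let 1ᵖ = con (+ 1) in
           1ᵖ :* (1ᵖ :* a :+ (:- 1ᵖ) :* b) :+ (:- 1ᵖ) :* (1ᵖ :* c :+ (:- 1ᵖ) :* d) := a :- b :- (c :- d))
         refl (M i i) (M i j) (M j i) (M j j) ⟩
    M i i - M i j - (M j i - M j j)
      ∎
    where
    g : Vector Carrier _
    g k = 1# * M k i + - 1# * M k j

  -- The least eigenvalue and the Rayleigh quotient.

  x≉0⇒0<x∙x : ∀ {n} (x : Vector Carrier n) → ¬ (∀ i → x i ≈ 0#) → 0# < x ∙ x
  x≉0⇒0<x∙x x x≉0 = ≰⇒> λ x∙x≤0 → x≉0 (x∙x≤0⇒x≈0 x x∙x≤0)

  -- The supremum μ of the lower bounds of the Rayleigh quotient is itself a lower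
  -- bound, so M - μ is positive semidefinite; it is not coercive, since then μ would
  -- not be an upper bound. Hence it has a kernel, and μ is an eigenvalue of M.
  module RayleighQuotient {n} (M : Matrix n) (M-sym : ∀ i j → M i j ≈ M j i) where

    LowerBound : Pred Carrier ℓ
    LowerBound t = ∀ x → t * (x ∙ x) ≤ form M x

    shift : Carrier → Matrix n
    shift t = M ⊖ diagonal (λ _ → t)

    shift-sym : ∀ t i j → shift t i j ≈ shift t j i
    shift-sym t i j = +-cong (M-sym i j) (-‿cong (diagonal-sym (λ _ → t) i j))

    shift-⊗ᵥ : ∀ t x i → (shift t ⊗ᵥ x) i ≈ 1# * (M ⊗ᵥ x) i + - t * x i
    shift-⊗ᵥ t x i = begin
      shift t i ∙ x
        ≈⟨ ∙-congʳ x (λ j → solve 2 (λ a b → a :- b := con (+ 1) :* a :+ (:- con (+ 1)) :* b) refl (M i j) (tI i j)) ⟩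
      (λ j → 1# * M i j + - 1# * tI i j) ∙ x
        ≈⟨ ∙-linearˡ 1# (- 1#) (M i) (tI i) x ⟩
      1# * (M i ∙ x) + - 1# * (tI i ∙ x)
        ≈⟨ +-congˡ (*-congˡ (diagonal-∙ (λ _ → t) i x)) ⟩
      1# * (M i ∙ x) + - 1# * (t * x i)
        ≈⟨ +-congˡ (solve 2 (λ t x → (:- con (+ 1)) :* (t :* x) := (:- t) :* x) refl t (x i)) ⟩
      1# * (M i ∙ x) + - t * x i
        ∎
      where
      tI : Matrix n
      tI = diagonal (λ _ → t)

    form-shift : ∀ t x → form (shift t) x ≈ form M x - t * (x ∙ x)
    form-shift t x = begin
      form (shift t) x                           ≈⟨ ∙-congˡ x (shift-⊗ᵥ t x) ⟩
      x ∙ (λ i → 1# * (M ⊗ᵥ x) i + - t * x i)    ≈⟨ ∙-linearʳ 1# (- t) x (M ⊗ᵥ x) x ⟩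
      1# * form M x + - t * (x ∙ x)
        ≈⟨ solve 3 (λ f t q → con (+ 1) :* f :+ (:- t) :* q := f :- t :* q) refl (form M x) t (x ∙ x) ⟩
      form M x - t * (x ∙ x)                     ∎

    shift-psd : ∀ {t} → LowerBound t → PositiveSemidefinite (shift t)
    shift-psd {t} t-bound = shift-sym t , λ x → ≤-resp refl (sym (form-shift t x)) (x≤y⇒0≤y-x (t-bound x))

    kernel⇒eigenvalue : ∀ {t} → ∃ (Kernel (shift t)) → IsEigenvalue M t
    kernel⇒eigenvalue {t} (x , x≉0 , ker) = x , x≉0 , λ i →
      linear-combination 1# (trans (sym (shift-⊗ᵥ t x i)) (ker i))
        (solve 3 (λ w t x → let 1ᵖ = con (+ 1) in
          w :- t :* x := 1ᵖ :* (1ᵖ :* w :+ (:- t) :* x :- con (+ 0))) refl ((M ⊗ᵥ x) i) t (x i))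

    lowerBound≤eigenvalue : ∀ {t μ} → LowerBound t → IsEigenvalue M μ → t ≤ μ
    lowerBound≤eigenvalue {t} {μ} t-bound (x , x≉0 , Mx≈μx) = 0≤y-x⇒x≤y
      (0<x∧0≤xy⇒0≤y (x≉0⇒0<x∙x x x≉0) (≤-resp refl
        (trans (+-congʳ (form-eigenvector M x Mx≈μx))
          (solve 3 (λ q t μ → μ :* q :- t :* q := q :* (μ :- t)) refl (x ∙ x) t μ))
        (x≤y⇒0≤y-x (t-bound x))))

    -- If `x ∙ x` is nonzero, the quotient at `x` is above every lower bound, hence above their
    -- least upper bound. If it is zero, `t` and `μ` give the same left-hand side, and the
    -- inequality for `t` is reused.
    supremum⇒lowerBound : ∀ {t μ} → LowerBound t → IsSupremum LowerBound μ → LowerBound μ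
    supremum⇒lowerBound {t} {μ} t-bound (_ , least) x with x ∙ x ≤.≟ 0#
    ... | yes q≈0 = ≤-resp
      (trans (*-congˡ q≈0) (trans (trans (zeroʳ t) (sym (zeroʳ μ))) (*-congˡ (sym q≈0)))) refl (t-bound x)
    ... | no  q≉0 = ≤-resp refl fq⁻¹q≈f (*-monoˡ-≤ (0≤x∙x x) (least (f * q ⁻¹) upper))
      where
      f = form M x
      q = x ∙ x

      0<q : 0# < q
      0<q = 0≤x∙x x , λ 0≈q → q≉0 (sym 0≈q)

      fq⁻¹q≈f : f * q ⁻¹ * q ≈ f
      fq⁻¹q≈f = linear-combination f (*-inverseʳ q≉0)
        (solve 3 (λ f q i → f :* i :* q :- f := f :* (q :* i :- con (+ 1))) refl f q (q ⁻¹))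

      upper : UpperBound LowerBound (f * q ⁻¹)
      upper {s} s-bound = 0≤y-x⇒x≤y (0<x∧0≤xy⇒0≤y 0<q (≤-resp refl
        (trans (+-congʳ (sym fq⁻¹q≈f)) (solve 3 (λ g q s → g :* q :- s :* q := q :* (g :- s)) refl (f * q ⁻¹) q s))
        (x≤y⇒0≤y-x (s-bound x))))

    supremum⇒¬coercive : ∀ {μ} → IsSupremum LowerBound μ → ¬ Coercive (shift μ)
    supremum⇒¬coercive {μ} (upper , _) (ε , 0<ε , ε-bound) = <⇒≱ 0<ε (0≤y-x⇒x≤y (≤-resp refl
      (solve 2 (λ μ ε → μ :- (μ :+ ε) := con (+ 0) :- ε) refl μ ε) (x≤y⇒0≤y-x (upper μ+ε-bound))))
      where
      μ+ε-bound : LowerBound (μ + ε)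
      μ+ε-bound x = difference-≥0⇒≤ (x≤y⇒0≤y-x (ε-bound x)) (trans (+-congʳ (form-shift μ x))
        (solve 4 (λ f μ ε q → f :- μ :* q :- ε :* q := f :- (μ :+ ε) :* q) refl (form M x) μ ε (x ∙ x)))

    -- The supremum `ν` of the lower bounds turns out to be an eigenvalue, so minimality of `μ`
    -- gives `μ ≤ ν`, and `μ` inherits the bound.
    smallestEigenvalue⇒lowerBound : ∀ {μ} → IsSmallestEigenvalue M μ → LowerBound μ
    smallestEigenvalue⇒lowerBound {μ} (μ-eigenvalue , μ-smallest) x =
      ≤.trans (*-monoˡ-≤ (0≤x∙x x) (alternative (kernel-or-coercive (shift ν) (shift-psd ν-bound)))) (ν-bound x)
      where
      ∃bound : ∃ LowerBound
      ∃bound = form-boundedBelow M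

      ∃sup : ∃ (IsSupremum LowerBound)
      -- The eigenvalue `μ` bounds the set from above; in dimension zero, where there are no
      -- eigenvalues, every number is a lower bound.
      ∃sup = supremum LowerBound ∃bound (μ , λ t-bound → lowerBound≤eigenvalue t-bound μ-eigenvalue)

      ν = proj₁ ∃sup

      ν-bound : LowerBound ν
      ν-bound = supremum⇒lowerBound (proj₂ ∃bound) (proj₂ ∃sup)

      alternative : ∃ (Kernel (shift ν)) ⊎ Coercive (shift ν) → μ ≤ ν
      alternative (inj₁ ker)      = μ-smallest ν (kernel⇒eigenvalue ker)
      alternative (inj₂ coercive) = ⊥-elim (supremum⇒¬coercive (proj₂ ∃sup) coercive)

-- The normalised adjacency matrix of a graph.

count-pos⇒∃ : ∀ {a p n} {A : Set a} {P : Pred A p} (P? : U.Decidable P) (xs : Vec A n) →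
              1 ℕ.≤ Vec.count P? xs → ∃ P
count-pos⇒∃ P? (x Vec.∷ xs) 1≤count with P? x
... | yes px = x , px
... | no  _  = count-pos⇒∃ P? xs 1≤count

module NormalizedAdjacency {ℓ} (ℝ : CompleteOrderedField ℓ) {n} (G : SimpleGraph n)
                           (1≤deg : ∀ v → 1 ℕ.≤ SimpleGraph.degree G v) where
  open CompleteOrderedField ℝ hiding (zero)
  open Matrices ℝ
  open OrderedField ℝ
  open QuadraticForms ℝ
  open IntegerCoefficients commutativeRing
  open SimpleGraph G
  open GraphMatrices G
  open import Algebra.Properties.Semiring.Sum semiring using (sum-cong-≋)
  open import Relation.Binary.Reasoning.Setoid setoid

  A-sym : ∀ u v → A u v ≈ A v u
  A-sym u v with u ~? v | v ~? u
  ... | yes _   | yes _   = refl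
  ... | yes u~v | no  v≁u = contradiction (~-sym u~v) v≁u
  ... | no  u≁v | yes v~u = contradiction (~-sym v~u) u≁v
  ... | no  _   | no  _   = refl

  A-edge : ∀ {u v} → u ~ v → A u v ≈ 1#
  A-edge {u} {v} u~v with u ~? v
  ... | yes _   = refl
  ... | no  u≁v = contradiction u~v u≁v

  A-loop : ∀ v → A v v ≈ 0#
  A-loop v with v ~? v
  ... | yes v~v = contradiction v~v (~-irrefl ≡.refl)
  ... | no  _   = refl

  d r s : Vector Carrier n
  d v = degree v · 1#
  r v = √ (d v) (0≤n·1 (degree v))
  s v = r v ⁻¹

  1≤d : ∀ v → 1# ≤ d v
  1≤d v = 1≤n·1 (1≤deg v)
    where
    1≤n·1 : ∀ {k} → 1 ℕ.≤ k → 1# ≤ k · 1#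
    1≤n·1 {ℕ.suc k} _ = ≤-resp (+-identityʳ 1#) refl (+-mono-≤ ≤.refl (0≤n·1 k))

  0<r : ∀ v → 0# < r v
  0<r v = √-pos (0≤n·1 (degree v)) (1≤d v)

  0<s : ∀ v → 0# < s v
  0<s v = 0<x⇒0<x⁻¹ (0<r v)

  rs≈1 : ∀ v → r v * s v ≈ 1#
  rs≈1 v = *-inverseʳ (0<x⇒x≉0 (0<r v))

  -- The diagonal entry of `D^-½ D D^-½ = I`; this is where the root must square exactly to the
  -- degree.
  sds≈1 : ∀ v → s v * (d v * s v) ≈ 1#
  sds≈1 v = trans
    (*-congˡ (*-congʳ (sym (√-square (0≤n·1 (degree v)) (1≤d v)))))
    (linear-combination (r v * s v + 1#) (rs≈1 v)
      (solve 2 (λ r s → let 1ᵖ = con (+ 1) in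
        s :* (r :* r :* s) :- 1ᵖ := (r :* s :+ 1ᵖ) :* (r :* s :- 1ᵖ)) refl (r v) (s v)))

  𝒜≈ : ∀ u v → 𝒜 u v ≈ s u * A u v * s v
  𝒜≈ = diagonal-⊗-diagonal s A

  𝒜-sym : ∀ u v → 𝒜 u v ≈ 𝒜 v u
  𝒜-sym u v = begin
    𝒜 u v                ≈⟨ 𝒜≈ u v ⟩
    s u * A u v * s v    ≈⟨ *-congʳ (*-congˡ (A-sym u v)) ⟩
    s u * A v u * s v    ≈⟨ solve 3 (λ a m b → a :* m :* b := b :* m :* a) refl (s u) (A v u) (s v) ⟩
    s v * A v u * s u    ≈⟨ 𝒜≈ v u ⟨
    𝒜 v u                ∎

  B-sym : ∀ α u v → B α u v ≈ B α v u
  B-sym α u v = +-cong (*-congˡ (A-sym u v)) (*-congˡ (+-cong (diagonal-sym d u v) (-‿cong (A-sym u v))))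

  form-B : ∀ α x → form (B α) (λ v → s v * x v) ≈ (1# - α) * (x ∙ x) + (α + α - 1#) * form 𝒜 x
  form-B α x = trans
    (form-linear (1# - α) (α + α - 1#) y λ u v →
      solve 3 (λ α a d → let 1ᵖ = con (+ 1) in
        α :* a :+ (1ᵖ :- α) :* (d :- a) := (1ᵖ :- α) :* d :+ (α :+ α :- 1ᵖ) :* a) refl α (A u v) (D u v))
    (+-cong (*-congˡ form-D) (*-congˡ (sym (form-congruence s 𝒜≈ x))))
    where
    y : Vector Carrier n
    y v = s v * x v

    form-D : form D y ≈ x ∙ x
    form-D = trans (form-diagonal d y) (sum-cong-≋ λ v → linear-combination (x v * x v) (sds≈1 v)
      (solve 3 (λ s d x → s :* x :* (d :* (s :* x)) :- x :* x := x :* x :* (s :* (d :* s) :- con (+ 1)))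
        refl (s v) (d v) (x v)))

  -- The substitution read backwards: positive semidefiniteness concerns every `x`, and `y = D^½ x`
  -- reaches each of them.
  form-B′ : ∀ α x → let y = λ v → r v * x v in
            form (B α) x ≈ (1# - α) * (y ∙ y) + (α + α - 1#) * form 𝒜 y
  form-B′ α x = trans
    (form-congʳ (B α) λ v → sym (linear-combination (x v) (rs≈1 v)
      (solve 3 (λ r s x → s :* (r :* x) :- x := x :* (r :* s :- con (+ 1))) refl (r v) (s v) (x v))))
    (form-B α (λ v → r v * x v))

  -- At the difference of the basis vectors of `u` and `v` the form of `𝒜` is `- 2 s u s v < 0`,
  -- whereas `t ≥ 0` would keep it nonnegative.
  edge⇒lowerBound<0 : ∀ {u v t} → u ~ v → (∀ x → t * (x ∙ x) ≤ form 𝒜 x) → t < 0#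
  edge⇒lowerBound<0 {u} {v} {t} u~v t-bound =
    ≰⇒> λ 0≤t → <⇒≱ 0<2ss (0≤y-x⇒x≤y (≤.trans (*-nonNegative 0≤t (0≤x∙x y)) (≤-resp refl form-y≈ (t-bound y))))
    where
    y : Vector Carrier n
    y k = 1# * δ u k + - 1# * δ v k

    0<ss = 0<x∧0<y⇒0<xy (0<s u) (0<s v)

    0<2ss : 0# < s u * s v + s u * s v
    0<2ss = 0<x∧0≤y⇒0<x+y 0<ss (proj₁ 0<ss)

    𝒜-loop : ∀ v → 𝒜 v v ≈ s v * 0# * s v
    𝒜-loop v = trans (𝒜≈ v v) (*-congʳ (*-congˡ (A-loop v)))

    𝒜-edge : ∀ {u v} → u ~ v → 𝒜 u v ≈ s u * 1# * s v
    𝒜-edge {u} {v} u~v = trans (𝒜≈ u v) (*-congʳ (*-congˡ (A-edge u~v)))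

    form-y≈ : form 𝒜 y ≈ 0# - (s u * s v + s u * s v)
    form-y≈ = trans (form-δ-δ 𝒜 u v) (trans
      (+-cong (+-cong (𝒜-loop u) (-‿cong (𝒜-edge u~v)))
              (-‿cong (+-cong (𝒜-edge (~-sym u~v)) (-‿cong (𝒜-loop v)))))
      (solve 2 (λ a b → let 0ᵖ = con (+ 0) ; 1ᵖ = con (+ 1) in
           a :* 0ᵖ :* a :- a :* 1ᵖ :* b :- (b :* 1ᵖ :* a :- b :* 0ᵖ :* b) := 0ᵖ :- (a :* b :+ a :* b))
        refl (s u) (s v)))

-- With ι = (2λ - 1)⁻¹ < 0 and B₀ = B at α₀ = (λ - 1) ι, the coefficients in form-B are
-- 1 - α₀ = λ ι and 2 α₀ - 1 = - ι, so xᵀ B₀ x is (- ι) (yᵀ 𝒜 y - λ yᵀ y).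
theorem2p4 : ∀ {ℓ} (ℝ : CompleteOrderedField ℓ) →
    let open CompleteOrderedField ℝ
        open Matrices ℝ in
    ∀ {n : ℕ} (G : SimpleGraph n) →
    let open GraphMatrices G in
    HasMinDegree G 1 →
    ∀ λₙ → IsSmallestEigenvalue 𝒜 λₙ →
    IsMaximum (λ α → 0# < α × α < 1# × PositiveSemidefinite (B α))
              ((λₙ - 1#) * ((1# + 1#) * λₙ - 1#) ⁻¹)
theorem2p4 ℝ {n} G ((v₀ , deg-v₀≡1) , 1≤deg) λₙ λₙ-smallest@((x , x≉0 , 𝒜x≈λₙx) , _) =
  (0<α₀ , α₀<1 , B-sym α₀ , 0≤form-B) , upper
  where
  open CompleteOrderedField ℝ
  open Matrices ℝ
  open OrderedField ℝ
  open QuadraticForms ℝ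
  open IntegerCoefficients commutativeRing
  open SimpleGraph G
  open GraphMatrices G
  open NormalizedAdjacency ℝ G 1≤deg
  open RayleighQuotient 𝒜 𝒜-sym

  λₙ-bound : LowerBound λₙ
  λₙ-bound = smallestEigenvalue⇒lowerBound λₙ-smallest

  neighbour : ∃ (v₀ ~_)
  -- The vertex of degree one supplies the edge that makes `λₙ` negative.
  neighbour = count-pos⇒∃ (v₀ ~?_) (Vec.allFin n) (ℕ.≤-reflexive (≡.sym deg-v₀≡1))

  p = (1# + 1#) * λₙ - 1#
  ι = p ⁻¹
  α₀ = (λₙ - 1#) * ι

  λₙ<0 : λₙ < 0#
  λₙ<0 = edge⇒lowerBound<0 (proj₂ neighbour) λₙ-bound

  0<-λₙ : 0# < - λₙ
  0<-λₙ = <-respʳ (+-identityˡ (- λₙ)) (x<y⇒0<y-x λₙ<0)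

  0<-p : 0# < - p
  0<-p = <-respʳ
    (solve 1 (λ l → let 1ᵖ = con (+ 1) in 1ᵖ :+ (:- l :+ :- l) := :- ((1ᵖ :+ 1ᵖ) :* l :- 1ᵖ)) refl λₙ)
    (0<x∧0≤y⇒0<x+y 0<1 (0≤-+ (proj₁ 0<-λₙ) (proj₁ 0<-λₙ)))

  pι≈1 : p * ι ≈ 1#
  pι≈1 = *-inverseʳ λ p≈0 → 0<x⇒x≉0 0<-p
    (trans (-‿cong p≈0) (solve 0 (:- con (+ 0) := con (+ 0)) refl))

  0<-ι : 0# < - ι
  0<-ι = 0<x∧0<xy⇒0<y 0<-p (<-respʳ
    (trans (sym pι≈1) (solve 2 (λ p i → p :* i := (:- p) :* (:- i)) refl p ι)) 0<1)

  0<α₀ : 0# < α₀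
  0<α₀ = <-respʳ
    (solve 2 (λ l i → let 1ᵖ = con (+ 1) in (1ᵖ :+ :- l) :* (:- i) := (l :- 1ᵖ) :* i) refl λₙ ι)
    (0<x∧0<y⇒0<xy (0<x∧0≤y⇒0<x+y 0<1 (proj₁ 0<-λₙ)) 0<-ι)

  α₀<1 : α₀ < 1#
  α₀<1 = 0<y-x⇒x<y (<-respʳ
    (linear-combination 1# pι≈1
      (solve 2 (λ l i → let 1ᵖ = con (+ 1) in
           (:- l) :* (:- i) :- (1ᵖ :- (l :- 1ᵖ) :* i) := 1ᵖ :* (((1ᵖ :+ 1ᵖ) :* l :- 1ᵖ) :* i :- 1ᵖ)) refl λₙ ι))
    (0<x∧0<y⇒0<xy 0<-λₙ 0<-ι))

  0≤form-B : ∀ x → 0# ≤ form (B α₀) x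
  0≤form-B x = ≤-resp refl
    (sym (trans (form-B′ α₀ x) (linear-combination (form 𝒜 y - y ∙ y) pι≈1
      (solve 4 (λ l i q f → let 1ᵖ = con (+ 1) ; α = (l :- 1ᵖ) :* i in
           ((1ᵖ :- α) :* q :+ (α :+ α :- 1ᵖ) :* f) :- (:- i) :* (f :- l :* q)
        := (f :- q) :* (((1ᵖ :+ 1ᵖ) :* l :- 1ᵖ) :* i :- 1ᵖ)) refl λₙ ι (y ∙ y) (form 𝒜 y)))))
    (*-nonNegative (proj₁ 0<-ι) (x≤y⇒0≤y-x (λₙ-bound y)))
    where
    y : Vector Carrier n
    y v = r v * x v

  upper : UpperBound (λ α → 0# < α × α < 1# × PositiveSemidefinite (B α)) α₀
  -- The coefficient equals `(1 - λₙ) + α p`, so multiplying it by `- ι` gives exactly `α₀ - α`, on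
  -- either side of ½.
  upper {α} (_ , _ , _ , 0≤B) = difference-≥0⇒≤ (*-nonNegative (proj₁ 0<-ι) 0≤coefficient)
    (linear-combination (- α) pι≈1
      (solve 3 (λ l i α → let 1ᵖ = con (+ 1) in
           (:- i) :* ((1ᵖ :- α) :+ (α :+ α :- 1ᵖ) :* l) :- ((l :- 1ᵖ) :* i :- α)
        := (:- α) :* (((1ᵖ :+ 1ᵖ) :* l :- 1ᵖ) :* i :- 1ᵖ)) refl λₙ ι α))
    where
    0≤coefficient : 0# ≤ (1# - α) + (α + α - 1#) * λₙ
    -- The form of `B α` is tested at `D^-½ x` for the eigenvector `x`, where it is `x ∙ x` times
    -- the coefficient.
    0≤coefficient = 0<x∧0≤xy⇒0≤y (x≉0⇒0<x∙x x x≉0) (≤-resp refl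
      (trans (form-B α x) (trans (+-congˡ (*-congˡ (form-eigenvector 𝒜 x 𝒜x≈λₙx)))
        (solve 4 (λ a b l q → a :* q :+ b :* (l :* q) := q :* (a :+ b :* l)) refl (1# - α) (α + α - 1#) λₙ (x ∙ x))))
      (0≤B (λ v → s v * x v)))
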